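{- Let $n\ge 3$ and $1\le r\le n-2$ be integers with $n$ odd and $r$ even, and let $K_n$ be the complete graph on $n$ vertices. Then \[ \left\lfloor \frac{rn-1}{2}\right\rfloor-1\le cms_r(K_n)\le \left\lfloor \frac{rn-1}{2}\right\rfloor. \]
   Context: All graphs are simple. For an integer $N$, $[N]=\{0,1,\dots,N-1\}$. An ordering of a graph $G=(V,E)$ is a bijection $\ell:E\to[|E|]$; edges are cyclically consecutive in $\ell$ if their labels are consecutive integers modulo $|E|$. A graph is $(\le r)$-regular if every vertex has degree at most $r$. For an ordering $\ell$ of $G$, $cms_r(\ell)$ is the largest integer $s$ such that every $s$ cyclically consecutive edges of $\ell$ form a $(\le r)$-regular subgraph of $G$; $cms_r(G)$ is the maximum of $cms_r(\ell)$ over all orderings $\ell$ of $G$. -}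

module Defs where

open import Data.Nat using (ℕ; zero; suc; _+_; _*_; _∸_; _≤_; _<_; _≟_)
open import Data.Nat.DivMod using (_%_)
open import Data.Fin using (Fin; toℕ)
import Data.Fin as F
open import Data.Product using (Σ; _×_; _,_; proj₁; proj₂)
open import Data.List using (List; upTo; length; filter; map; allFin)
open import Data.Bool using (Bool; true; false; _∧_; _∨_; T)
open import Data.Bool.ListAction using (any)
open import Function.Bundles using (_↔_; Inverse)
open import Relation.Nullary.Decidable using (⌊_⌋; T?)

-- The complete graph K_n: vertex set Fin n; an edge is an unordered pair {i,j}
-- with i ≠ j, represented canonically as (i , j) with i < j.
Edge : ℕ → Set
Edge n = Σ (Fin n × Fin n) (λ p → proj₁ p F.< proj₂ p)

numEdges : ℕ → ℕ
numEdges zero = 0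
numEdges (suc n) = n + numEdges n

Ordering : ℕ → Set
Ordering n = Edge n ↔ Fin (numEdges n)

-- x mod m (for m = 0 there are no labels, the value is irrelevant)
_mod_ : ℕ → ℕ → ℕ
x mod zero = x
x mod suc m = x % suc m

incidentᵇ : ∀ {n} → Fin n → Edge n → Bool
incidentᵇ v ((i , j) , _) = ⌊ v F.≟ i ⌋ ∨ ⌊ v F.≟ j ⌋

inWindowᵇ : (m k s x : ℕ) → Bool
inWindowᵇ m k s x = any (λ t → ⌊ (k + t) mod m ≟ x ⌋) (upTo s)

windowDegree : ∀ {n} → Ordering n → (k s : ℕ) → Fin n → ℕ
windowDegree {n} ℓ k s v =
  length (filter (λ e → T? (incidentᵇ v e ∧ inWindowᵇ (numEdges n) k s (toℕ (Inverse.to ℓ e))))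
                 (map (Inverse.from ℓ) (allFin (numEdges n))))

AllWindowsRegular : ∀ {n} → (r : ℕ) → Ordering n → (s : ℕ) → Set
AllWindowsRegular {n} r ℓ s = (k : Fin (numEdges n)) (v : Fin n) → windowDegree ℓ (toℕ k) s v ≤ r

IsCms : ∀ {n} → (r : ℕ) → Ordering n → ℕ → Set
IsCms r ℓ c = AllWindowsRegular r ℓ c × (∀ s → AllWindowsRegular r ℓ s → s ≤ c)

IsCmsK : ℕ → ℕ → ℕ → Set
IsCmsK n r c = Σ (Ordering n) (λ ℓ → IsCms r ℓ c)
             × (∀ (ℓ : Ordering n) c' → IsCms r ℓ c' → c' ≤ c)

{-# OPTIONS --safe #-}

-- Write n = 2m + 1 and r = 2q, so that the upper bound is qn - 1.
--
-- Upper bound: if every window of qn edges were (≤ 2q)-regular, then by counting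
-- degrees every window would be 2q-regular; shifting a window by one would then
-- replace an edge by itself, which is impossible since qn < |E| = mn.
--
-- Lower bound: on ℤ/n the edges {x , x + d}, 1 ≤ d ≤ m, form m edge-disjoint
-- 2-factors. Each is listed with x running through c, c + 1, c - 1, c + 2, …,
-- so that a prefix of length a + 2 covers, for both endpoints, the intervals
-- covered by a prefix of length a of a 2-factor whose centres are moved by at
-- most one, as happens when d changes by at most 2. Hence windows of qn - 2
-- edges are (≤ 2q)-regular once the 2-factors are concatenated so that those at
-- cyclic distance q have differences at distance at most 2; this is possible
-- since each orbit of i ↦ i + q on ℤ/m can be laid out on an interval in the
-- cyclic order 0, 2, 4, …, 5, 3, 1.
module Submission where

open import Defs
open import Data.Nat using (ℕ; zero; suc; pred; _+_; _*_; _∸_; _^_; _≤_; _<_; _>_; _/_; _%_; _≟_; _≤?_; _<?_; _⊓_; ⌊_/2⌋; ⌈_/2⌉; NonZero; z≤n; s≤s; >-nonZero; >-nonZero⁻¹; ≢-nonZero; ≢-nonZero⁻¹)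
open import Data.Nat.Properties
open import Data.Nat.DivMod using (m%n<n; m<n⇒m%n≡m; %-distribˡ-+; [m+kn]%n≡m%n; m≡m%n+[m/n]*n; m%n%n≡m%n; m<n*o⇒m/o<n; m∣n⇒o%n%m≡o%m; %-remove-+ʳ; %-congʳ; m%[n*o]/o≡m/o%n; +-distrib-/-∣ʳ; m*n/n≡m; m/n*n≡m) renaming (_mod_ to _modᶠ_)
open import Data.Nat.Divisibility using (_∣_; divides; n∣m*n; *-monoˡ-∣; ∣n⇒∣m*n; *-cancelʳ-∣; m%n≡0⇒n∣m; n∣m⇒m%n≡0; >⇒∤)
open import Data.Nat.GCD using (gcd; gcd[m,n]∣m; gcd[m,n]∣n; gcd[m,n]≢0)
open import Data.Nat.Coprimality using (coprime-/gcd; coprime-divisor)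
open import Data.Nat.Solver using (module +-*-Solver)
open import Data.Bool using (Bool; true; false; _∧_; _∨_; T)
open import Data.Bool.Properties using (∧-identityʳ)
open import Data.Empty using (⊥)
open import Data.Fin using (Fin; zero; suc; toℕ; fromℕ<; punchOut; finToFun; funToFin)
import Data.Fin as F
import Data.Fin.Properties as FP
open import Data.List using (upTo; length; filter; map; allFin; tabulate)
open import Data.List.Properties using (map-tabulate)
open import Data.List.Membership.Propositional using (find; lose)
open import Data.List.Membership.Propositional.Properties using (∈-upTo⁺; ∈-upTo⁻)
open import Data.List.Relation.Unary.Any.Properties using (any⁺; any⁻)
open import Data.Product using (Σ; ∃; _×_; _,_; proj₁; proj₂)
open import Data.Sum using (_⊎_; inj₁; inj₂)
open import Function using (_∘_; id; const)
open import Function.Bundles using (Inverse; mk↔ₛ′)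
open import Function.Definitions using (Injective)
open import Relation.Nullary using (¬_; Dec; yes; no; contradiction)
open import Relation.Nullary.Decidable using (⌊_⌋; T?; toWitness; fromWitness; _→-dec_; map′)
open import Relation.Binary.Definitions using (Tri; tri<; tri≈; tri>)
open import Relation.Binary.PropositionalEquality using (_≡_; _≢_; _≗_; refl; sym; trans; cong; cong₂; subst; subst₂; module ≡-Reasoning)
open import Algebra.Properties.CommutativeMonoid.Sum +-0-commutativeMonoid using (sum; ∑-distrib-+; sum-cong-≗; sum-replicate-zero)

-- Truth values as the numbers 0 and 1

⟦_⟧ : Bool → ℕ
⟦ true ⟧  = 1
⟦ false ⟧ = 0

⟦⟧-mono : ∀ {a b} → (T a → T b) → ⟦ a ⟧ ≤ ⟦ b ⟧
⟦⟧-mono {false} f = z≤n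
⟦⟧-mono {true} {true} f = ≤-refl
⟦⟧-mono {true} {false} f = contradiction (f _) λ ()

⟦⟧-injective : ∀ {a b} → ⟦ a ⟧ ≡ ⟦ b ⟧ → a ≡ b
⟦⟧-injective {true}  {true}  _ = refl
⟦⟧-injective {false} {false} _ = refl

⌊⌋-cong : ∀ {A B : Set} (a? : Dec A) (b? : Dec B) → (A → B) → (B → A) → ⌊ a? ⌋ ≡ ⌊ b? ⌋
⌊⌋-cong (yes a) (yes b) f g = refl
⌊⌋-cong (yes a) (no ¬b) f g = contradiction (f a) ¬b
⌊⌋-cong (no ¬a) (yes b) f g = contradiction (g b) ¬a
⌊⌋-cong (no ¬a) (no ¬b) f g = refl

⟦∨⟧-disjoint : ∀ a b → ¬ (T a × T b) → ⟦ a ∨ b ⟧ ≡ ⟦ a ⟧ + ⟦ b ⟧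
⟦∨⟧-disjoint false b     d = refl
⟦∨⟧-disjoint true  false d = refl
⟦∨⟧-disjoint true  true  d = contradiction _ d

∧-zeroʳ-⟦⟧ : ∀ a → ⟦ a ∧ false ⟧ ≡ 0
∧-zeroʳ-⟦⟧ true  = refl
∧-zeroʳ-⟦⟧ false = refl

⟦∧∨⟧-disjoint : ∀ a b c → ¬ (T b × T c) → ⟦ a ∧ (b ∨ c) ⟧ ≡ ⟦ a ∧ b ⟧ + ⟦ a ∧ c ⟧
⟦∧∨⟧-disjoint true  b c d = ⟦∨⟧-disjoint b c d
⟦∧∨⟧-disjoint false b c d = refl

-- Finite sums

sumTo : (ℕ → ℕ) → ℕ → ℕ
sumTo f zero    = 0
sumTo f (suc n) = sumTo f n + f n

sumTo-cong : ∀ {f g} n → (∀ {t} → t < n → f t ≡ g t) → sumTo f n ≡ sumTo g n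
sumTo-cong zero    eq = refl
sumTo-cong (suc n) eq = cong₂ _+_ (sumTo-cong n (eq ∘ m<n⇒m<1+n)) (eq ≤-refl)

sumTo-+ : ∀ f a b → sumTo f (a + b) ≡ sumTo f a + sumTo (f ∘ (a +_)) b
sumTo-+ f a zero    = trans (cong (sumTo f) (+-identityʳ a)) (sym (+-identityʳ _))
sumTo-+ f a (suc b) = trans (cong (sumTo f) (+-suc a b))
  (trans (cong (_+ f (a + b)) (sumTo-+ f a b)) (+-assoc (sumTo f a) _ _))

sumTo-distrib-+ : ∀ f g n → sumTo (λ t → f t + g t) n ≡ sumTo f n + sumTo g n
sumTo-distrib-+ f g zero    = refl
sumTo-distrib-+ f g (suc n) = trans (cong (_+ (f n + g n)) (sumTo-distrib-+ f g n))
  (solve 4 (λ a b c d → (a :+ b) :+ (c :+ d) := (a :+ c) :+ (b :+ d)) refl (sumTo f n) (sumTo g n) (f n) (g n))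
  where open +-*-Solver

sumTo-mono : ∀ f {a b} → a ≤ b → sumTo f a ≤ sumTo f b
sumTo-mono f {a} {b} a≤b = subst (λ c → sumTo f a ≤ sumTo f c) (m+[n∸m]≡n a≤b)
  (≤-trans (m≤m+n _ _) (≤-reflexive (sym (sumTo-+ f a (b ∸ a)))))

sumTo-const : ∀ c n → sumTo (const c) n ≡ n * c
sumTo-const c zero    = refl
sumTo-const c (suc n) = trans (cong (_+ c) (sumTo-const c n)) (+-comm (n * c) c)

sum-mono : ∀ {n} {f g : Fin n → ℕ} → (∀ i → f i ≤ g i) → sum f ≤ sum g
sum-mono {zero}  le = z≤n
sum-mono {suc n} le = +-mono-≤ (le zero) (sum-mono (le ∘ suc))

sum-bounded : ∀ {n} {f : Fin n → ℕ} {c} → (∀ i → f i ≤ c) → sum f ≤ n * c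
sum-bounded {zero}  le = z≤n
sum-bounded {suc n} le = +-mono-≤ (le zero) (sum-bounded (le ∘ suc))

-- The equality case of `sum-bounded`: no term can fall short, since the others cannot make up for
-- it. It turns the degree count of the upper bound into exact regularity.
sum-tight : ∀ {n} {f : Fin n → ℕ} {c} → (∀ i → f i ≤ c) → n * c ≤ sum f → ∀ i → f i ≡ c
sum-tight {suc n} {f} {c} le tight zero = ≤-antisym (le zero)
  (+-cancelʳ-≤ (n * c) c (f zero) (≤-trans tight (+-monoʳ-≤ (f zero) (sum-bounded (le ∘ suc)))))
sum-tight {suc n} {f} {c} le tight (suc i) = sum-tight (le ∘ suc)
  (+-cancelˡ-≤ c (n * c) _ (≤-trans tight (+-monoˡ-≤ _ (le zero)))) i

-- Used for double counting: incidences are summed by vertices on the left, by edges of a window on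
-- the right.
sum-sumTo-comm : ∀ {n} (f : Fin n → ℕ → ℕ) s →
                 sum (λ i → sumTo (f i) s) ≡ sumTo (λ t → sum (λ i → f i t)) s
sum-sumTo-comm {n} f zero    = sum-replicate-zero n
sum-sumTo-comm     f (suc s) = trans (∑-distrib-+ (λ i → sumTo (f i) s) (λ i → f i s))
  (cong (_+ sum (λ i → f i s)) (sum-sumTo-comm f s))

sum-select : ∀ {n} (g : Fin n → Bool) (i : Fin n) →
             sum (λ p → ⟦ g p ∧ ⌊ toℕ i ≟ toℕ p ⌋ ⟧) ≡ ⟦ g i ⟧
sum-select {suc n} g zero = trans (cong₂ _+_ (cong ⟦_⟧ (∧-identityʳ (g zero)))
    (trans (sum-cong-≗ (λ p → ∧-zeroʳ-⟦⟧ (g (suc p)))) (sum-replicate-zero n))) (+-identityʳ _)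
sum-select {suc n} g (suc i) = cong₂ _+_ (∧-zeroʳ-⟦⟧ (g zero))
  (trans (sum-cong-≗ (λ p → cong (λ b → ⟦ g (suc p) ∧ b ⟧)
            (⌊⌋-cong (suc (toℕ i) ≟ suc (toℕ p)) (toℕ i ≟ toℕ p) suc-injective (cong suc))))
         (sum-select (g ∘ suc) i))

length-filter-tabulate : ∀ {A : Set} (g : A → Bool) {n} (f : Fin n → A) →
  length (filter (T? ∘ g) (tabulate f)) ≡ sum (⟦_⟧ ∘ g ∘ f)
length-filter-tabulate g {zero}  f = refl
length-filter-tabulate g {suc n} f with g (f zero)
... | true  = cong suc (length-filter-tabulate g (f ∘ suc))
... | false = length-filter-tabulate g (f ∘ suc)

-- Congruences modulo n

%-cancelˡ : ∀ c {a b} n .{{_ : NonZero n}} → (c + a) % n ≡ (c + b) % n → a % n ≡ b % n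
%-cancelˡ c {a} {b} n eq = trans (sym ([m+kn]%n≡m%n a y n)) (trans (cong (_% n) key) ([m+kn]%n≡m%n b x n))
  where
  x = (c + a) / n
  y = (c + b) / n
  open +-*-Solver
  -- Each side receives the multiple of `n` belonging to the other side, which avoids subtraction.
  key : a + y * n ≡ b + x * n
  key = +-cancelˡ-≡ c _ _ (begin
    c + (a + y * n)                  ≡⟨ +-assoc c a _ ⟨
    c + a + y * n                    ≡⟨ cong (_+ y * n) (m≡m%n+[m/n]*n (c + a) n) ⟩
    (c + a) % n + x * n + y * n      ≡⟨ cong (λ z → z + x * n + y * n) eq ⟩
    (c + b) % n + x * n + y * n      ≡⟨ solve 3 (λ a b c → a :+ b :+ c := a :+ c :+ b) refl ((c + b) % n) (x * n) (y * n) ⟩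
    (c + b) % n + y * n + x * n      ≡⟨ cong (_+ x * n) (m≡m%n+[m/n]*n (c + b) n) ⟨
    c + b + x * n                    ≡⟨ +-assoc c b _ ⟩
    c + (b + x * n)                  ∎)
    where open ≡-Reasoning

%-injective : ∀ {a b} n .{{_ : NonZero n}} → a < n → b < n → a % n ≡ b % n → a ≡ b
%-injective n a<n b<n eq = trans (sym (m<n⇒m%n≡m a<n)) (trans eq (m<n⇒m%n≡m b<n))

toℕ-modᶠ : ∀ a n .{{_ : NonZero n}} → toℕ (a modᶠ n) ≡ a % n
toℕ-modᶠ a n = FP.toℕ-fromℕ< (m%n<n a n)

modᶠ-cong : ∀ {a b} n .{{_ : NonZero n}} → a % n ≡ b % n → a modᶠ n ≡ b modᶠ n
modᶠ-cong {a} {b} n eq = FP.toℕ-injective (trans (toℕ-modᶠ a n) (trans eq (sym (toℕ-modᶠ b n))))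

mod≡% : ∀ a n .{{_ : NonZero n}} → a mod n ≡ a % n
mod≡% a (suc n) = refl

-- Window degrees

inWindow⁻ : ∀ N k s x → T (inWindowᵇ N k s x) → ∃ λ t → t < s × (k + t) mod N ≡ x
inWindow⁻ N k s x w with find (any⁻ (λ t → ⌊ (k + t) mod N ≟ x ⌋) (upTo s) w)
... | t , t∈ , eq = t , ∈-upTo⁻ t∈ , toWitness eq

inWindow⁺ : ∀ N k s x {t} → t < s → (k + t) mod N ≡ x → T (inWindowᵇ N k s x)
inWindow⁺ N k s x t<s eq = any⁺ (λ t → ⌊ (k + t) mod N ≟ x ⌋) (lose (∈-upTo⁺ t<s) (fromWitness eq))

inWindow-mono : ∀ N k {s s′} x → s ≤ s′ → T (inWindowᵇ N k s x) → T (inWindowᵇ N k s′ x)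
inWindow-mono N k {s} {s′} x s≤s′ w with inWindow⁻ N k s x w
... | t , t<s , eq = inWindow⁺ N k s′ x (<-≤-trans t<s s≤s′) eq

T-injective : ∀ a b → (T a → T b) → (T b → T a) → a ≡ b
T-injective a b f g = ⟦⟧-injective (≤-antisym (⟦⟧-mono f) (⟦⟧-mono g))

T-∨⁻ : ∀ a {b} → T (a ∨ b) → T a ⊎ T b
T-∨⁻ true  p = inj₁ p
T-∨⁻ false p = inj₂ p

T-∨⁺ : ∀ a {b} → T a ⊎ T b → T (a ∨ b)
T-∨⁺ true  _        = _
T-∨⁺ false (inj₂ p) = p

inWindow-suc : ∀ N k s x → inWindowᵇ N k (suc s) x ≡ inWindowᵇ N k s x ∨ ⌊ (k + s) mod N ≟ x ⌋
inWindow-suc N k s x = T-injective _ _ to from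
  where
  to : T (inWindowᵇ N k (suc s) x) → T (inWindowᵇ N k s x ∨ ⌊ (k + s) mod N ≟ x ⌋)
  to w with inWindow⁻ N k (suc s) x w
  ... | t , t<1+s , eq with m<1+n⇒m<n∨m≡n t<1+s
  ...   | inj₁ t<s  = T-∨⁺ (inWindowᵇ N k s x) (inj₁ (inWindow⁺ N k s x t<s eq))
  ...   | inj₂ refl = T-∨⁺ (inWindowᵇ N k s x) (inj₂ (fromWitness eq))
  from : T (inWindowᵇ N k s x ∨ ⌊ (k + s) mod N ≟ x ⌋) → T (inWindowᵇ N k (suc s) x)
  from w with T-∨⁻ (inWindowᵇ N k s x) w
  ... | inj₁ p = inWindow-mono N k x (n≤1+n s) p
  ... | inj₂ p = inWindow⁺ N k (suc s) x ≤-refl (toWitness p)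

module _ {n : ℕ} where

  private N = numEdges n

  edgeAt : Ordering n → Fin N → Edge n
  edgeAt ℓ = Inverse.from ℓ

  windowDegree-sum : ∀ ℓ k s v →
    windowDegree ℓ k s v ≡ sum (λ p → ⟦ incidentᵇ v (edgeAt ℓ p) ∧ inWindowᵇ N k s (toℕ p) ⟧)
  windowDegree-sum ℓ k s v = begin
    length (filter (T? ∘ g) (map (edgeAt ℓ) (allFin N))) ≡⟨ cong (length ∘ filter (T? ∘ g)) (map-tabulate id (edgeAt ℓ)) ⟩
    length (filter (T? ∘ g) (tabulate (edgeAt ℓ)))       ≡⟨ length-filter-tabulate g (edgeAt ℓ) ⟩
    sum (⟦_⟧ ∘ g ∘ edgeAt ℓ)                             ≡⟨ sum-cong-≗ (λ p → cong (λ x → ⟦ incidentᵇ v (edgeAt ℓ p) ∧ inWindowᵇ N k s (toℕ x) ⟧) (Inverse.strictlyInverseˡ ℓ p)) ⟩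
    _                                                    ∎
    where
    open ≡-Reasoning
    g : Edge n → Bool
    g e = incidentᵇ v e ∧ inWindowᵇ N k s (toℕ (Inverse.to ℓ e))

  windowDegree-mono : ∀ ℓ k {s s′} v → s ≤ s′ → windowDegree ℓ k s v ≤ windowDegree ℓ k s′ v
  windowDegree-mono ℓ k {s} {s′} v s≤s′ = subst₂ _≤_ (sym (windowDegree-sum ℓ k s v)) (sym (windowDegree-sum ℓ k s′ v))
    (sum-mono (λ p → ⟦⟧-mono (∧-monoʳ (incidentᵇ v (edgeAt ℓ p)) (inWindow-mono N k (toℕ p) s≤s′))))
    where
    ∧-monoʳ : ∀ a {b c} → (T b → T c) → T (a ∧ b) → T (a ∧ c)
    ∧-monoʳ true f = f

  windowDegree-cong : ∀ ℓ ℓ′ → edgeAt ℓ ≗ edgeAt ℓ′ → ∀ k s v → windowDegree ℓ k s v ≡ windowDegree ℓ′ k s v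
  windowDegree-cong ℓ ℓ′ eq k s v = trans (windowDegree-sum ℓ k s v)
    (trans (sum-cong-≗ (λ p → cong (λ e → ⟦ incidentᵇ v e ∧ inWindowᵇ N k s (toℕ p) ⟧) (eq p)))
           (sym (windowDegree-sum ℓ′ k s v)))

  -- Positions are read modulo `N`, so that a cyclic window becomes an interval of natural numbers.
  incidence : .{{NonZero N}} → Ordering n → Fin n → ℕ → ℕ
  incidence ℓ v p = ⟦ incidentᵇ v (edgeAt ℓ (p modᶠ N)) ⟧

  -- For `s ≤ N` the positions of the window are distinct modulo `N`, so lengthening it by one adds
  -- exactly one new label. In a longer window the right side would count edges repeatedly.
  windowDegree-sumTo : .{{_ : NonZero N}} → ∀ ℓ k s v → s ≤ N →
    windowDegree ℓ k s v ≡ sumTo (incidence ℓ v ∘ (k +_)) s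
  windowDegree-sumTo ℓ k s v s≤N = trans (windowDegree-sum ℓ k s v) (go s s≤N)
    where
    g : Fin N → Bool
    g p = incidentᵇ v (edgeAt ℓ p)
    disjoint : ∀ s x → s < N → ¬ (T (inWindowᵇ N k s x) × T ⌊ (k + s) mod N ≟ x ⌋)
    disjoint s x s<N (w , eq) with inWindow⁻ N k s x w
    ... | t , t<s , eq′ = <⇒≢ t<s (%-injective N (<-trans t<s s<N) s<N (%-cancelˡ k N
            (trans (sym (mod≡% (k + t) N)) (trans eq′ (trans (sym (toWitness eq)) (mod≡% (k + s) N))))))
    go : ∀ s → s ≤ N → sum (λ p → ⟦ g p ∧ inWindowᵇ N k s (toℕ p) ⟧) ≡ sumTo (incidence ℓ v ∘ (k +_)) s
    go zero    _   = trans (sum-cong-≗ (λ p → ∧-zeroʳ-⟦⟧ (g p))) (sum-replicate-zero N)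
    go (suc s) s<N = begin
      sum (λ p → ⟦ g p ∧ inWindowᵇ N k (suc s) (toℕ p) ⟧)
        ≡⟨ sum-cong-≗ (λ p → trans (cong (λ b → ⟦ g p ∧ b ⟧) (inWindow-suc N k s (toℕ p)))
                                   (⟦∧∨⟧-disjoint (g p) _ _ (disjoint s (toℕ p) s<N))) ⟩
      sum (λ p → ⟦ g p ∧ inWindowᵇ N k s (toℕ p) ⟧ + ⟦ g p ∧ ⌊ (k + s) mod N ≟ toℕ p ⌋ ⟧)
        ≡⟨ ∑-distrib-+ (λ p → ⟦ g p ∧ inWindowᵇ N k s (toℕ p) ⟧) _ ⟩
      sum (λ p → ⟦ g p ∧ inWindowᵇ N k s (toℕ p) ⟧) + sum (λ p → ⟦ g p ∧ ⌊ (k + s) mod N ≟ toℕ p ⌋ ⟧)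
        ≡⟨ cong₂ _+_ (go s (<⇒≤ s<N))
             (trans (sum-cong-≗ (λ p → cong (λ x → ⟦ g p ∧ ⌊ x ≟ toℕ p ⌋ ⟧) (trans (mod≡% (k + s) N) (sym (toℕ-modᶠ (k + s) N)))))
                    (sum-select g ((k + s) modᶠ N))) ⟩
      sumTo (incidence ℓ v ∘ (k +_)) (suc s) ∎
      where open ≡-Reasoning

-- Incidence counts and the upper bound

incident-split : ∀ {n} (v i j : Fin n) → i ≢ j → ⟦ ⌊ v F.≟ i ⌋ ∨ ⌊ v F.≟ j ⌋ ⟧ ≡ ⟦ ⌊ v F.≟ i ⌋ ⟧ + ⟦ ⌊ v F.≟ j ⌋ ⟧
incident-split v i j i≢j = ⟦∨⟧-disjoint ⌊ v F.≟ i ⌋ ⌊ v F.≟ j ⌋ (λ (a , b) → i≢j (trans (sym (toWitness a)) (toWitness b)))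

edge-≢ : ∀ {n} (e : Edge n) → proj₁ (proj₁ e) ≢ proj₂ (proj₁ e)
edge-≢ (_ , i<j) refl = <-irrefl refl i<j

sum-incident : ∀ {n} (e : Edge n) → sum (λ v → ⟦ incidentᵇ v e ⟧) ≡ 2
sum-incident {n} e@((i , j) , _) = trans (sum-cong-≗ (λ v → incident-split v i j (edge-≢ e)))
  (trans (∑-distrib-+ (λ v → ⟦ ⌊ v F.≟ i ⌋ ⟧) (λ v → ⟦ ⌊ v F.≟ j ⌋ ⟧)) (cong₂ _+_ (one i) (one j)))
  where
  one : ∀ (i : Fin n) → sum (λ v → ⟦ ⌊ v F.≟ i ⌋ ⟧) ≡ 1
  one i = trans (sum-cong-≗ (λ v → cong ⟦_⟧ (⌊⌋-cong (v F.≟ i) (toℕ i ≟ toℕ v) (cong toℕ ∘ sym) (sym ∘ FP.toℕ-injective))))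
                (sum-select (const true) i)

edge-≡ : ∀ {n} {e e′ : Edge n} → proj₁ e ≡ proj₁ e′ → e ≡ e′
edge-≡ {e = p , i<j} {.p , i<j′} refl = cong (p ,_) (≤-irrelevant i<j i<j′)

-- Both endpoints of `e` lie on `e′`; of the four ways to match them, `i < j` and `i′ < j′` leave
-- only the identity.
incident-injective : ∀ {n} (e e′ : Edge n) → (∀ v → incidentᵇ v e ≡ incidentᵇ v e′) → e ≡ e′
incident-injective e@((i , j) , i<j) e′@((i′ , j′) , i′<j′) eq
  with endpoint i (subst T (eq i) (T-∨⁺ ⌊ i F.≟ i ⌋ (inj₁ (fromWitness refl))))
     | endpoint j (subst T (eq j) (T-∨⁺ ⌊ j F.≟ i ⌋ (inj₂ (fromWitness refl))))
  where
  endpoint : ∀ v → T (incidentᵇ v e′) → v ≡ i′ ⊎ v ≡ j′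
  endpoint v p with T-∨⁻ ⌊ v F.≟ i′ ⌋ p
  ... | inj₁ q = inj₁ (toWitness q)
  ... | inj₂ q = inj₂ (toWitness q)
... | inj₁ refl | inj₁ refl = contradiction i<j (<-irrefl refl)
... | inj₁ refl | inj₂ refl = edge-≡ refl
... | inj₂ refl | inj₁ refl = contradiction i<j (<-asym i′<j′)
... | inj₂ refl | inj₂ refl = contradiction i<j (<-irrefl refl)

no-regular-windows : ∀ {n} q → 0 < q * n → q * n < numEdges n →
  (ℓ : Ordering n) → ¬ AllWindowsRegular (q * 2) ℓ (q * n)
no-regular-windows {n} q 0<s s<N ℓ reg = <⇒≢ 0<s (%-injective N 0<N s<N
    (trans (sym (toℕ-modᶠ 0 N)) (trans (cong toℕ same-position) (toℕ-modᶠ s N))))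
  where
  N = numEdges n
  s = q * n
  0<N : 0 < N
  0<N = <-trans 0<s s<N
  1<N : 1 < N
  1<N = ≤-<-trans 0<s s<N
  instance
    N≢0 : NonZero N
    N≢0 = >-nonZero 0<N
  deg : ℕ → Fin n → ℕ
  deg k v = sumTo (incidence ℓ v ∘ (k +_)) s
  deg≤ : ∀ k → k < N → ∀ v → deg k v ≤ q * 2
  deg≤ k k<N v = subst (_≤ q * 2)
    (trans (cong (λ k → windowDegree ℓ k s v) (FP.toℕ-fromℕ< k<N)) (windowDegree-sumTo ℓ k s v (<⇒≤ s<N)))
    (reg (fromℕ< k<N) v)
  -- Each of the `s` edges has two endpoints. The total is `n` times the allowed degree `q * 2`, so
  -- no vertex can stay below it.
  sum-deg : ∀ k → sum (deg k) ≡ s * 2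
  sum-deg k = trans (sum-sumTo-comm (λ v → incidence ℓ v ∘ (k +_)) s)
    (trans (sumTo-cong s (λ {t} _ → sum-incident (edgeAt ℓ ((k + t) modᶠ N)))) (sumTo-const 2 s))
  deg≡ : ∀ k → k < N → ∀ v → deg k v ≡ q * 2
  deg≡ k k<N = sum-tight (deg≤ k k<N) (≤-reflexive (trans (solve 2 (λ n q → n :* (q :* con 2) := q :* n :* con 2) refl n q) (sym (sum-deg k))))
    where open +-*-Solver
  -- The positions 0, ..., s are 0 followed by the window at 1, and also the window at 0 followed by
  -- s; the two windows have equal degrees.
  exchange : ∀ v → incidence ℓ v 0 ≡ incidence ℓ v s
  exchange v = +-cancelʳ-≡ (deg 1 v) _ _ (begin
    incidence ℓ v 0 + deg 1 v       ≡⟨ sumTo-+ (incidence ℓ v) 1 s ⟨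
    sumTo (incidence ℓ v) (suc s)   ≡⟨ +-comm (deg 0 v) _ ⟩
    incidence ℓ v s + deg 0 v       ≡⟨ cong (incidence ℓ v s +_) (trans (deg≡ 0 0<N v) (sym (deg≡ 1 1<N v))) ⟩
    incidence ℓ v s + deg 1 v       ∎)
    where open ≡-Reasoning
  same-edge : edgeAt ℓ (0 modᶠ N) ≡ edgeAt ℓ (s modᶠ N)
  same-edge = incident-injective _ _ (λ v → ⟦⟧-injective (exchange v))
  same-position : 0 modᶠ N ≡ s modᶠ N
  same-position = trans (sym (Inverse.strictlyInverseˡ ℓ _)) (trans (cong (Inverse.to ℓ) same-edge) (Inverse.strictlyInverseˡ ℓ _))

regular-mono : ∀ {n} r {s s′} (ℓ : Ordering n) → s ≤ s′ → AllWindowsRegular r ℓ s′ → AllWindowsRegular r ℓ s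
regular-mono r ℓ s≤s′ reg k v = ≤-trans (windowDegree-mono ℓ (toℕ k) v s≤s′) (reg k v)

-- Orderings from injective sequences of edges

-- If `y` were missed, punching it out would give an injection from `Fin (suc n)` into `Fin n`.
injective⇒surjective : ∀ {n} {f : Fin n → Fin n} → Injective _≡_ _≡_ f → ∀ y → ∃ λ x → f x ≡ y
injective⇒surjective {suc n} {f} inj y with FP.any? (λ x → f x F.≟ y)
... | yes hit = hit
... | no miss = contradiction (FP.injective⇒≤ {f = λ x → punchOut (miss′ x)}
                  (λ {x} {x′} eq → inj (FP.punchOut-injective (miss′ x) (miss′ x′) eq))) 1+n≰n
  where
  miss′ : ∀ x → y ≢ f x
  miss′ x eq = miss (x , sym eq)

numEdges-mono : ∀ {a b} → a ≤ b → numEdges a ≤ numEdges b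
numEdges-mono z≤n       = z≤n
numEdges-mono (s≤s a≤b) = +-mono-≤ a≤b (numEdges-mono a≤b)

-- Pairs are coded by i + C(j, 2), the combinatorial number system. The codes with larger entry j
-- fill the interval from C(j, 2) up to C(j + 1, 2), so these intervals are disjoint for different
-- j.
pair-code-< : ∀ {i j k} → i < j → j < k → i + numEdges j < numEdges k
pair-code-< {i} {j} i<j j<k = <-≤-trans (+-monoˡ-< (numEdges j) i<j) (numEdges-mono j<k)

encode : ∀ {n} → Edge n → Fin (numEdges n)
encode ((i , j) , i<j) = fromℕ< (pair-code-< i<j (FP.toℕ<n j))

encode-injective : ∀ {n} (e e′ : Edge n) → encode e ≡ encode e′ → e ≡ e′
encode-injective ((i , j) , i<j) ((i′ , j′) , i′<j′) eq = go (<-cmp (toℕ j) (toℕ j′))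
  where
  code≡ : toℕ i + numEdges (toℕ j) ≡ toℕ i′ + numEdges (toℕ j′)
  code≡ = FP.fromℕ<-injective _ _ _ _ eq
  go : Tri (toℕ j < toℕ j′) (toℕ j ≡ toℕ j′) (toℕ j > toℕ j′) → ((i , j) , i<j) ≡ ((i′ , j′) , i′<j′)
  go (tri< j<j′ _ _) = contradiction code≡ (<⇒≢ (<-≤-trans (pair-code-< i<j j<j′) (m≤n+m _ _)))
  go (tri> _ _ j′<j) = contradiction (sym code≡) (<⇒≢ (<-≤-trans (pair-code-< i′<j′ j′<j) (m≤n+m _ _)))
  go (tri≈ _ j≡j′ _) with refl ← FP.toℕ-injective j≡j′ = edge-≡ (cong (_, j)
    (FP.toℕ-injective (+-cancelʳ-≡ (numEdges (toℕ j)) _ _ code≡)))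

module _ {n : ℕ} (f : Fin (numEdges n) → Edge n) (inj : Injective _≡_ _≡_ f) where

  private
    -- `encode ∘ f` is an injective self-map of a finite set, hence onto; injectivity of `encode`
    -- then identifies `f p` with `e`.
    locate : (e : Edge n) → ∃ λ p → encode (f p) ≡ encode e
    locate e = injective⇒surjective {f = encode ∘ f} (inj ∘ encode-injective _ _) (encode e)

  orderingOf : Ordering n
  orderingOf = mk↔ₛ′ (proj₁ ∘ locate) f
    (λ p → inj (encode-injective _ _ (proj₂ (locate (f p)))))
    (λ e → encode-injective _ _ (proj₂ (locate e)))

-- Deciding whether a regular ordering exists

regular? : ∀ {n} r (ℓ : Ordering n) s → Dec (AllWindowsRegular r ℓ s)
regular? r ℓ s = FP.all? (λ k → FP.all? (λ v → windowDegree ℓ (toℕ k) s v ≤? r))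

regular-cong : ∀ {n} r s (ℓ ℓ′ : Ordering n) → edgeAt ℓ ≗ edgeAt ℓ′ →
               AllWindowsRegular r ℓ s → AllWindowsRegular r ℓ′ s
regular-cong r s ℓ ℓ′ eq reg k v = subst (_≤ r) (windowDegree-cong ℓ ℓ′ eq (toℕ k) s v) (reg k v)

injective? : ∀ {a b} (f : Fin a → Fin b) → Dec (Injective _≡_ _≡_ f)
injective? f = map′ (λ inj {x} {y} → inj x y) (λ inj x y → inj {x} {y})
  (FP.all? (λ x → FP.all? (λ y → (f x F.≟ f y) →-dec (x F.≟ y))))

edgeAt-injective : ∀ {n} (ℓ : Ordering n) → Injective _≡_ _≡_ (edgeAt ℓ)
edgeAt-injective ℓ eq = trans (sym (Inverse.strictlyInverseˡ ℓ _)) (trans (cong (Inverse.to ℓ) eq) (Inverse.strictlyInverseˡ ℓ _))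

-- Every ordering is a rearrangement of ℓ₀, and the self-maps of Fin N are
-- enumerated by Fin (N ^ N).
regularOrdering? : ∀ {n} r s → Ordering n → Dec (Σ (Ordering n) λ ℓ → AllWindowsRegular r ℓ s)
regularOrdering? {n} r s ℓ₀ = map′ to from (FP.any? good?)
  where
  N = numEdges n
  rearrange : (σ : Fin N → Fin N) → Injective _≡_ _≡_ σ → Ordering n
  rearrange σ inj = orderingOf (edgeAt ℓ₀ ∘ σ) (inj ∘ edgeAt-injective ℓ₀)
  Good : Fin (N ^ N) → Set
  Good c = Σ (Injective _≡_ _≡_ (finToFun {N} {N} c)) λ inj → AllWindowsRegular r (rearrange (finToFun c) inj) s
  good? : ∀ c → Dec (Good c)
  good? c with injective? (finToFun {N} {N} c)
  ... | no ¬inj = no (¬inj ∘ proj₁)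
  -- The rearranged ordering is built from a proof of injectivity, but its sequence of edges is the
  -- same for every such proof.
  ... | yes inj = map′ (inj ,_)
    (λ (inj′ , reg) → regular-cong r s (rearrange (finToFun c) inj′) (rearrange (finToFun c) inj) (λ _ → refl) reg)
    (regular? r (rearrange (finToFun c) inj) s)
  to : ∃ Good → Σ (Ordering n) λ ℓ → AllWindowsRegular r ℓ s
  to (c , inj , reg) = rearrange (finToFun c) inj , reg
  from : (Σ (Ordering n) λ ℓ → AllWindowsRegular r ℓ s) → ∃ Good
  -- `σ` sends a position in `ℓ` to the label of its edge under `ℓ₀`. Decoding its code gives back
  -- `σ` only pointwise, which `regular-cong` absorbs.
  from (ℓ , reg) = funToFin σ , inj , regular-cong r s ℓ (rearrange (finToFun (funToFin σ)) inj)
      (λ p → sym (trans (cong (edgeAt ℓ₀) (FP.finToFun-funToFin σ p)) (Inverse.strictlyInverseʳ ℓ₀ _))) reg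
    where
    σ : Fin N → Fin N
    σ = Inverse.to ℓ₀ ∘ edgeAt ℓ
    σ-inj : Injective _≡_ _≡_ σ
    σ-inj eq = edgeAt-injective ℓ (trans (sym (Inverse.strictlyInverseʳ ℓ₀ _)) (trans (cong (edgeAt ℓ₀) eq) (Inverse.strictlyInverseʳ ℓ₀ _)))
    inj : Injective _≡_ _≡_ (finToFun {N} {N} (funToFin σ))
    inj eq = σ-inj (trans (sym (FP.finToFun-funToFin σ _)) (trans eq (FP.finToFun-funToFin σ _)))

-- Edges from two distinct vertices

mkEdge : ∀ {n} (u v : Fin n) → u ≢ v → Edge n
mkEdge u v u≢v with FP.<-cmp u v
... | tri< u<v _ _ = (u , v) , u<v
... | tri≈ _ u≡v _ = contradiction u≡v u≢v
... | tri> _ _ v<u = (v , u) , v<u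

incident-mkEdge : ∀ {n} (x u v : Fin n) (u≢v : u ≢ v) →
  ⟦ incidentᵇ x (mkEdge u v u≢v) ⟧ ≡ ⟦ ⌊ x F.≟ u ⌋ ⟧ + ⟦ ⌊ x F.≟ v ⌋ ⟧
incident-mkEdge x u v u≢v with FP.<-cmp u v
... | tri< u<v _ _ = incident-split x u v u≢v
... | tri≈ _ u≡v _ = contradiction u≡v u≢v
... | tri> _ _ v<u = trans (incident-split x v u (u≢v ∘ sym)) (+-comm ⟦ ⌊ x F.≟ v ⌋ ⟧ _)

mkEdge-injective : ∀ {n} {u v u′ v′ : Fin n} (ne : u ≢ v) (ne′ : u′ ≢ v′) → mkEdge u v ne ≡ mkEdge u′ v′ ne′ →
                   (u ≡ u′ × v ≡ v′) ⊎ (u ≡ v′ × v ≡ u′)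
mkEdge-injective {u = u} {v} {u′} {v′} ne ne′ eq with FP.<-cmp u v | FP.<-cmp u′ v′
... | tri≈ _ u≡v _ | _ = contradiction u≡v ne
... | _ | tri≈ _ u≡v _ = contradiction u≡v ne′
... | tri< _ _ _ | tri< _ _ _ = inj₁ (cong (proj₁ ∘ proj₁) eq , cong (proj₂ ∘ proj₁) eq)
... | tri< _ _ _ | tri> _ _ _ = inj₂ (cong (proj₁ ∘ proj₁) eq , cong (proj₂ ∘ proj₁) eq)
... | tri> _ _ _ | tri< _ _ _ = inj₂ (cong (proj₂ ∘ proj₁) eq , cong (proj₁ ∘ proj₁) eq)
... | tri> _ _ _ | tri> _ _ _ = inj₁ (cong (proj₂ ∘ proj₁) eq , cong (proj₁ ∘ proj₁) eq)

-- A cyclic arrangement with short steps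

-- Stands for |a - b| ≤ c, free of subtraction.
Within : ℕ → ℕ → ℕ → Set
Within c a b = a ≤ c + b × b ≤ c + a

-- The arrangement 0, 2, 4, …, 5, 3, 1 of [L], whose cyclic steps are at most 2.
cyc : ℕ → ℕ → ℕ
cyc L k = (k * 2) ⊓ suc ((L ∸ suc k) * 2)

*2-Within : ∀ {a b} → Within 1 a b → Within 2 (a * 2) (b * 2)
*2-Within (p , q) = *-monoˡ-≤ 2 p , *-monoˡ-≤ 2 q

∸-Within : ∀ L {a b} → Within 1 a b → Within 1 (L ∸ a) (L ∸ b)
∸-Within L {a} {b} (p , q) = le a b q , le b a p
  where
  le : ∀ a b → b ≤ suc a → L ∸ a ≤ suc (L ∸ b)
  le a b b≤1+a = begin
    L ∸ a             ≤⟨ suc-∸ L a ⟩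
    suc (L ∸ suc a)   ≤⟨ s≤s (∸-monoʳ-≤ L b≤1+a) ⟩
    suc (L ∸ b)       ∎
    where
    open ≤-Reasoning
    suc-∸ : ∀ L a → L ∸ a ≤ suc (L ∸ suc a)
    suc-∸ zero    zero    = z≤n
    suc-∸ zero    (suc a) = z≤n
    suc-∸ (suc L) zero    = ≤-refl
    suc-∸ (suc L) (suc a) = suc-∸ L a

-- Both arguments of the minimum change by at most 2, and taking a minimum preserves this.
cyc-step : ∀ L k → Within 2 (cyc L k) (cyc L (suc k))
cyc-step L k = ⊓-mono-≤ (proj₁ p) (s≤s (proj₁ q)) , ⊓-mono-≤ (proj₂ p) (s≤s (proj₂ q))
  where
  p = *2-Within {k} {suc k} (≤-trans (n≤1+n k) (n≤1+n _) , ≤-refl)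
  q = *2-Within (∸-Within L {suc k} {suc (suc k)} (≤-trans (n≤1+n _) (n≤1+n _) , ≤-refl))

cyc-wrap : ∀ k → Within 2 (cyc (suc k) k) (cyc (suc k) 0)
cyc-wrap k = ≤-trans (m⊓n≤n (k * 2) _) (≤-trans (≤-reflexive (cong (λ z → suc (z * 2)) (n∸n≡0 k))) (s≤s z≤n)) , z≤n

m*2≢1+n*2 : ∀ a b → a * 2 ≢ suc (b * 2)
m*2≢1+n*2 (suc a) (suc b) eq = m*2≢1+n*2 a b (suc-injective (suc-injective eq))

-- The parity of the value tells which argument of the minimum is attained, and each argument is
-- injective in `k`.
cyc-injective : ∀ L {k k′} → k < L → k′ < L → cyc L k ≡ cyc L k′ → k ≡ k′
cyc-injective L {k} {k′} k<L k′<L eq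
  with ⊓-sel (k * 2) (suc ((L ∸ suc k) * 2)) | ⊓-sel (k′ * 2) (suc ((L ∸ suc k′) * 2))
... | inj₁ p | inj₁ p′ = *-cancelʳ-≡ k k′ 2 (trans (sym p) (trans eq p′))
... | inj₁ p | inj₂ p′ = contradiction (trans (sym p) (trans eq p′)) (m*2≢1+n*2 k (L ∸ suc k′))
... | inj₂ p | inj₁ p′ = contradiction (trans (sym p′) (trans (sym eq) p)) (m*2≢1+n*2 k′ (L ∸ suc k))
... | inj₂ p | inj₂ p′ = suc-injective (∸-cancelˡ-≡ k<L k′<L
        (*-cancelʳ-≡ (L ∸ suc k) (L ∸ suc k′) 2 (suc-injective (trans (sym p) (trans eq p′)))))

-- The two arguments of the minimum add up to 2L - 1, so the smaller one is below `L`.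
cyc-< : ∀ L {k} → k < L → cyc L k < L
cyc-< L {k} k<L with k * 2 <? L
... | yes lt = ≤-<-trans (m⊓n≤m _ _) lt
... | no ¬lt = ≤-<-trans (m⊓n≤n (k * 2) _) (+-cancelʳ-< (k * 2) _ L (begin-strict
    suc ((L ∸ suc k) * 2) + k * 2      <⟨ ≤-refl ⟩
    suc (suc ((L ∸ suc k) * 2) + k * 2) ≡⟨ solve 2 (λ a b → con 2 :+ a :* con 2 :+ b :* con 2 := (a :+ (con 1 :+ b)) :* con 2) refl (L ∸ suc k) k ⟩
    (L ∸ suc k + suc k) * 2            ≡⟨ cong (_* 2) (m∸n+n≡m k<L) ⟩
    L * 2                              ≡⟨ solve 1 (λ a → a :* con 2 := a :+ a) refl L ⟩
    L + L                              ≤⟨ +-monoʳ-≤ L (≮⇒≥ ¬lt) ⟩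
    L + k * 2                          ∎))
  where
  open ≤-Reasoning
  open +-*-Solver

quot-rem-unique : ∀ L .{{_ : NonZero L}} {a a′ b b′} → b < L → b′ < L → a * L + b ≡ a′ * L + b′ → a ≡ a′ × b ≡ b′
quot-rem-unique L {a} {a′} {b} {b′} b<L b′<L eq = *-cancelʳ-≡ a a′ L (+-cancelʳ-≡ b _ _ (trans eq (cong (a′ * L +_) (sym b≡b′)))) , b≡b′
  where
  b≡b′ : b ≡ b′
  b≡b′ = %-injective L b<L b′<L (trans (sym ([m+kn]%n≡m%n b a L)) (trans (cong (_% L) (trans (+-comm b _) (trans eq (+-comm _ b′)))) ([m+kn]%n≡m%n b′ a′ L)))

m≡[m/n]*n+m%n : ∀ a L .{{_ : NonZero L}} → a ≡ a / L * L + a % L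
m≡[m/n]*n+m%n a L = trans (m≡m%n+[m/n]*n a L) (+-comm (a % L) _)

-- The orbits of i ↦ i + q on ℤ/m are the residue classes modulo g = gcd m q,
-- of length L = m / g; orbit j is arranged cyclically on the interval
-- [jL , jL + L).
module Arrangement (m q : ℕ) .{{m≢0 : NonZero m}} where

  private
    g = gcd m q
    instance
      g≢0 : NonZero g
      g≢0 = ≢-nonZero (gcd[m,n]≢0 m q (inj₁ (≢-nonZero⁻¹ m)))
    L = m / g
    m≡L*g : m ≡ L * g
    m≡L*g = sym (m/n*n≡m (gcd[m,n]∣m m q))
    instance
      L≢0 : NonZero L
      L≢0 = ≢-nonZero (λ L≡0 → ≢-nonZero⁻¹ m (trans m≡L*g (cong (_* g) L≡0)))
    m≡g*L : m ≡ g * L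
    m≡g*L = trans m≡L*g (*-comm L g)

    m∣L*q : m ∣ L * q
    m∣L*q = subst₂ _∣_ (sym m≡g*L) (*-comm q L) (*-monoˡ-∣ L (gcd[m,n]∣n m q))

    -- After cancelling `g`, `L` divides (q / g) e and is coprime to q / g. With `m∣L*q` this makes
    -- `L` the exact length of every orbit.
    m∣e*q⇒L∣e : ∀ e → m ∣ e * q → L ∣ e
    m∣e*q⇒L∣e e m∣eq = coprime-divisor (coprime-/gcd m q) (*-cancelʳ-∣ g (subst₂ _∣_ m≡L*g eq m∣eq))
      where
      open +-*-Solver
      eq : e * q ≡ q / g * e * g
      eq = trans (cong (e *_) (sym (m/n*n≡m (gcd[m,n]∣n m q))))
                 (solve 3 (λ e x g → e :* (x :* g) := x :* e :* g) refl e (q / g) g)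

    multiples-injective-≤ : ∀ {k k′} → k ≤ k′ → k′ < L → (k * q) % m ≡ (k′ * q) % m → k ≡ k′
    multiples-injective-≤ {k} {k′} k≤k′ k′<L eq with k′ ∸ k in e≡
    ... | zero  = ≤-antisym k≤k′ (m∸n≡0⇒m≤n e≡)
    ... | suc e = contradiction (m∣e*q⇒L∣e (suc e) (m%n≡0⇒n∣m _ m e*q≡0))
                    (>⇒∤ (≤-<-trans (subst (_≤ k′) e≡ (m∸n≤m k′ k)) k′<L))
      where
      k′≡ : k + suc e ≡ k′
      k′≡ = trans (cong (k +_) (sym e≡)) (m+[n∸m]≡n k≤k′)
      e*q≡0 : (suc e * q) % m ≡ 0
      e*q≡0 = sym (trans (sym (m<n⇒m%n≡m (>-nonZero⁻¹ m))) (%-cancelˡ (k * q) m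
        (trans (cong (_% m) (+-identityʳ (k * q))) (trans eq (cong (_% m)
          (trans (cong (_* q) (sym k′≡)) (*-distribʳ-+ q k (suc e))))))))

    multiples-injective : ∀ {k k′} → k < L → k′ < L → (k * q) % m ≡ (k′ * q) % m → k ≡ k′
    multiples-injective {k} {k′} k<L k′<L eq with ≤-total k k′
    ... | inj₁ k≤k′ = multiples-injective-≤ k≤k′ k′<L eq
    ... | inj₂ k′≤k = sym (multiples-injective-≤ k′≤k k<L (sym eq))

    -- The number jL + k stands for the k-th point on the orbit of j.
    visit : ℕ → ℕ
    visit c = c / L + c % L * q

    orbit : Fin m → Fin m
    orbit c = visit (toℕ c) modᶠ m

    -- Since `g` divides both `m` and `q`, reduction modulo `g` recovers j; cancelling it leaves two
    -- multiples of `q`.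
    visit-injective : ∀ {j k j′ k′} → j < g → j′ < g → k < L → k′ < L →
                      (j + k * q) % m ≡ (j′ + k′ * q) % m → j ≡ j′ × k ≡ k′
    visit-injective {j} {k} {j′} {k′} j<g j′<g k<L k′<L eq = j≡j′ , multiples-injective k<L k′<L
        (%-cancelˡ j m (trans eq (cong (λ z → (z + k′ * q) % m) (sym j≡j′))))
      where
      reduce : ∀ j k → (j + k * q) % m % g ≡ j % g
      reduce j k = trans (m∣n⇒o%n%m≡o%m g m (j + k * q) (gcd[m,n]∣m m q)) (%-remove-+ʳ j (∣n⇒∣m*n k (gcd[m,n]∣n m q)))
      j≡j′ : j ≡ j′
      j≡j′ = %-injective g j<g j′<g (trans (sym (reduce j k)) (trans (cong (_% g) eq) (reduce j′ k′)))

    quot< : ∀ (c : Fin m) → toℕ c / L < g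
    quot< c = m<n*o⇒m/o<n (subst (toℕ c <_) m≡g*L (FP.toℕ<n c))

    orbit-injective : Injective _≡_ _≡_ orbit
    orbit-injective {c} {c′} eq = FP.toℕ-injective (trans (m≡[m/n]*n+m%n (toℕ c) L)
        (trans (cong₂ (λ j k → j * L + k) (proj₁ p) (proj₂ p)) (sym (m≡[m/n]*n+m%n (toℕ c′) L))))
      where
      p = visit-injective (quot< c) (quot< c′) (m%n<n (toℕ c) L) (m%n<n (toℕ c′) L)
            (trans (sym (toℕ-modᶠ (visit (toℕ c)) m)) (trans (cong toℕ eq) (toℕ-modᶠ (visit (toℕ c′)) m)))

    -- The inverse of `orbit`, obtained from injectivity by finiteness.
    index : ℕ → Fin m
    index i = proj₁ (injective⇒surjective orbit-injective (i modᶠ m))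

    visit-index : ∀ i → visit (toℕ (index i)) % m ≡ i % m
    visit-index i = trans (sym (toℕ-modᶠ (visit (toℕ (index i))) m))
      (trans (cong toℕ (proj₂ (injective⇒surjective orbit-injective (i modᶠ m)))) (toℕ-modᶠ i m))

    -- The successor moves the values from [m] to the range 1, ..., m of the differences.
    place : ℕ → ℕ
    place c = suc (c / L * L + cyc L (c % L))

  arrange : ℕ → ℕ
  arrange i = place (toℕ (index i))

  arrange-% : ∀ i → arrange (i % m) ≡ arrange i
  arrange-% i = cong (λ z → place (toℕ (proj₁ (injective⇒surjective orbit-injective z)))) (modᶠ-cong m (m%n%n≡m%n i m))

  arrange-≤ : ∀ i → arrange i ≤ m
  arrange-≤ i = begin-strict
    c / L * L + cyc L (c % L)  <⟨ +-monoʳ-< (c / L * L) (cyc-< L (m%n<n c L)) ⟩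
    c / L * L + L              ≡⟨ +-comm _ L ⟩
    suc (c / L) * L            ≤⟨ *-monoˡ-≤ L (quot< (index i)) ⟩
    g * L                      ≡⟨ m≡g*L ⟨
    m                          ∎
    where
    open ≤-Reasoning
    c = toℕ (index i)

  arrange-injective : ∀ {i i′} → i < m → i′ < m → arrange i ≡ arrange i′ → i ≡ i′
  arrange-injective {i} {i′} i<m i′<m eq = %-injective m i<m i′<m
      (trans (sym (visit-index i)) (trans (cong (_% m) (cong₂ (λ j k → j + k * q) (proj₁ p) k≡)) (visit-index i′)))
    where
    c  = toℕ (index i)
    c′ = toℕ (index i′)
    p = quot-rem-unique L (cyc-< L (m%n<n c L)) (cyc-< L (m%n<n c′ L)) (suc-injective eq)
    k≡ : c % L ≡ c′ % L
    k≡ = cyc-injective L (m%n<n c L) (m%n<n c′ L) (proj₂ p)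

  private
    -- The successor within an orbit: k + 1, or 0 after the last point, because Lq is 0 modulo `m`.
    next : ∀ k → k < L → ∃ λ k′ → k′ < L × Within 2 (cyc L k) (cyc L k′) × (k′ * q) % m ≡ (suc k * q) % m
    next k k<L with m≤n⇒m<n∨m≡n k<L
    ... | inj₁ 1+k<L = suc k , 1+k<L , cyc-step L k , refl
    ... | inj₂ 1+k≡L = 0 , >-nonZero⁻¹ L , subst (λ L → Within 2 (cyc L k) (cyc L 0)) 1+k≡L (cyc-wrap k)
                     , trans (m<n⇒m%n≡m (>-nonZero⁻¹ m)) (sym (n∣m⇒m%n≡0 _ m (subst (λ z → m ∣ z * q) (sym 1+k≡L) m∣L*q)))

    suc-+-Within : ∀ j {a b} → Within 2 a b → Within 2 (suc (j + a)) (suc (j + b))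
    suc-+-Within j {a} {b} (x , y) = s≤s (le a b x) , s≤s (le b a y)
      where
      le : ∀ a b → a ≤ 2 + b → j + a ≤ 2 + (j + b)
      le a b h = ≤-trans (+-monoʳ-≤ j h) (≤-reflexive (trans (+-suc j (suc b)) (cong suc (+-suc j b))))

    %-congˡ-+ : ∀ a {b b′} → b % m ≡ b′ % m → (a + b) % m ≡ (a + b′) % m
    %-congˡ-+ a {b} {b′} eq = trans (%-distribˡ-+ a b m)
      (trans (cong (λ z → (a % m + z) % m) eq) (sym (%-distribˡ-+ a b′ m)))

    -- Adding `q` moves one step along the same orbit; by `visit-injective` the index `c′` has to be
    -- the one supplied by `next`.
    place-step : ∀ {i} (c c′ : Fin m) → visit (toℕ c) % m ≡ i % m → visit (toℕ c′) % m ≡ (i + q) % m →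
                 Within 2 (place (toℕ c)) (place (toℕ c′))
    place-step {i} c c′ eq eq′ with next (toℕ c % L) (m%n<n (toℕ c) L)
    ... | k′ , k′<L , near , k′q≡ = subst₂ (λ j k → Within 2 (place (toℕ c)) (suc (j * L + cyc L k)))
                                      (proj₁ p) (proj₂ p) (suc-+-Within (j * L) near)
      where
      j = toℕ c / L
      k = toℕ c % L
      open ≡-Reasoning
      open +-*-Solver
      same : (j + k′ * q) % m ≡ visit (toℕ c′) % m
      same = begin
        (j + k′ * q) % m      ≡⟨ %-congˡ-+ j k′q≡ ⟩
        (j + suc k * q) % m   ≡⟨ cong (_% m) (solve 3 (λ j k q → j :+ (con 1 :+ k) :* q := q :+ (j :+ k :* q)) refl j k q) ⟩
        (q + (j + k * q)) % m ≡⟨ %-congˡ-+ q eq ⟩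
        (q + i) % m           ≡⟨ cong (_% m) (+-comm q i) ⟩
        (i + q) % m           ≡⟨ eq′ ⟨
        visit (toℕ c′) % m    ∎
      p : j ≡ toℕ c′ / L × k′ ≡ toℕ c′ % L
      p = visit-injective (quot< c) (quot< c′) k′<L (m%n<n (toℕ c′) L) same

  arrange-step : ∀ i → Within 2 (arrange i) (arrange (i + q))
  arrange-step i = place-step (index i) (index (i + q)) (visit-index i) (visit-index (i + q))

-- Zigzag orderings of the 2-factors {x , x + d}

-- The sequence a, b, a - 1, b + 1, a - 2, …, only meaningful while a - j does
-- not truncate at 0.
zigzag : ℕ → ℕ → ℕ → ℕ
zigzag a b zero          = a
zigzag a b (suc zero)    = b
zigzag a b (suc (suc t)) = zigzag (pred a) (suc b) t

zigzag-even : ∀ a b j → zigzag a b (j * 2) ≡ a ∸ j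
zigzag-even a       b zero    = refl
zigzag-even zero    b (suc j) = trans (zigzag-even 0 (suc b) j) (0∸n≡0 j)
zigzag-even (suc a) b (suc j) = zigzag-even a (suc b) j

zigzag-odd : ∀ a b j → zigzag a b (suc (j * 2)) ≡ j + b
zigzag-odd a b zero    = refl
zigzag-odd a b (suc j) = trans (zigzag-odd (pred a) (suc b) j) (+-suc j b)

data Parity : ℕ → Set where
  even : ∀ j → Parity (j * 2)
  odd  : ∀ j → Parity (suc (j * 2))

parity : ∀ t → Parity t
parity zero = even 0
parity (suc t) with parity t
... | even j = odd j
... | odd j  = even (suc j)

m+m≡m*2 : ∀ m → m + m ≡ m * 2
m+m≡m*2 = solve 1 (λ m → m :+ m := m :* con 2) refl
  where open +-*-Solver

numEdges-odd : ∀ m → numEdges (suc (m * 2)) ≡ m * suc (m * 2)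
numEdges-odd zero    = refl
numEdges-odd (suc m) = trans (cong (λ z → suc (suc (m * 2)) + (suc (m * 2) + z)) (numEdges-odd m))
  (solve 1 (λ m → (con 2 :+ m :* con 2) :+ ((con 1 :+ m :* con 2) :+ m :* (con 1 :+ m :* con 2))
                  := (con 1 :+ m) :* (con 3 :+ m :* con 2)) refl m)
  where open +-*-Solver

sumTo-indicator : ∀ τ a → sumTo (λ t → ⟦ ⌊ τ ≟ t ⌋ ⟧) a ≡ ⟦ ⌊ τ <? a ⌋ ⟧
sumTo-indicator τ zero    = cong ⟦_⟧ (⌊⌋-cong {⊥} (no id) (τ <? 0) (λ ()) (λ ()))
sumTo-indicator τ (suc a) = trans (cong (_+ ⟦ ⌊ τ ≟ a ⌋ ⟧) (sumTo-indicator τ a)) (go (τ <? a) (τ ≟ a) (τ <? suc a))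
  where
  go : (x : Dec (τ < a)) (y : Dec (τ ≡ a)) (z : Dec (τ < suc a)) → ⟦ ⌊ x ⌋ ⟧ + ⟦ ⌊ y ⌋ ⟧ ≡ ⟦ ⌊ z ⌋ ⟧
  go (yes x) (yes y) _       = contradiction y (<⇒≢ x)
  go (yes x) (no ¬y) (yes z) = refl
  go (yes x) (no ¬y) (no ¬z) = contradiction (m<n⇒m<1+n x) ¬z
  go (no ¬x) (yes y) (yes z) = refl
  go (no ¬x) (yes refl) (no ¬z) = contradiction ≤-refl ¬z
  go (no ¬x) (no ¬y) (no ¬z) = refl
  go (no ¬x) (no ¬y) (yes z) = contradiction (≤∧≢⇒< (m<1+n⇒m≤n z) ¬y) ¬x

quotient-unique : ∀ n .{{_ : NonZero n}} i {t} → t < n → (i * n + t) / n ≡ i × (i * n + t) % n ≡ t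
quotient-unique n i {t} t<n = quot-rem-unique n {(i * n + t) / n} {i} {(i * n + t) % n} {t}
  (m%n<n (i * n + t) n) t<n (sym (m≡[m/n]*n+m%n (i * n + t) n))

incidence-orderingOf : ∀ {n} .{{_ : NonZero (numEdges n)}} (f : Fin (numEdges n) → Edge n) (inj : Injective _≡_ _≡_ f) v p →
  incidence (orderingOf f inj) v p ≡ ⟦ incidentᵇ v (f (p modᶠ numEdges n)) ⟧
incidence-orderingOf f inj v p = refl

-- The vertices met by a zigzag

module Hits (m : ℕ) where

  n : ℕ
  n = suc (m * 2)

  -- Starting in the middle of [n], the zigzag m, m + 1, m - 1, ... runs through all of 0, ..., 2m
  -- in `n` steps without truncation.
  w : ℕ → ℕ
  w = zigzag m (suc m)

  even<n : ∀ j → j * 2 < n → j ≤ m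
  even<n j lt = *-cancelʳ-≤ j m 2 (m<1+n⇒m≤n lt)

  odd<n : ∀ j → suc (j * 2) < n → j < m
  odd<n j (s≤s lt) = *-cancelʳ-< 2 j m lt

  -- Even positions carry values at most m, odd positions values above m.
  even≢oddʷ : ∀ j j′ → w (j * 2) ≢ w (suc (j′ * 2))
  even≢oddʷ j j′ eq = <⇒≢ (≤-<-trans (m∸n≤m m j) (m≤n+m (suc m) j′))
    (trans (sym (zigzag-even m (suc m) j)) (trans eq (zigzag-odd m (suc m) j′)))

  w-injective : ∀ {t t′} → t < n → t′ < n → w t ≡ w t′ → t ≡ t′
  w-injective {t} {t′} t<n t′<n eq with parity t | parity t′
  ... | even j | even j′ = cong (_* 2) (∸-cancelˡ-≡ (even<n j t<n) (even<n j′ t′<n)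
          (trans (sym (zigzag-even m (suc m) j)) (trans eq (zigzag-even m (suc m) j′))))
  ... | odd j  | odd j′  = cong (λ z → suc (z * 2)) (+-cancelʳ-≡ (suc m) j j′
          (trans (sym (zigzag-odd m (suc m) j)) (trans eq (zigzag-odd m (suc m) j′))))
  ... | even j | odd j′  = contradiction eq (even≢oddʷ j j′)
  ... | odd j  | even j′ = contradiction (sym eq) (even≢oddʷ j′ j)

  w-< : ∀ {t} → t < n → w t < n
  w-< {t} t<n with parity t
  ... | even j = s≤s (≤-trans (≤-reflexive (zigzag-even m (suc m) j)) (≤-trans (m∸n≤m m j) (m≤m*n m 2)))
  ... | odd j  = s≤s (begin
    w (suc (j * 2)) ≡⟨ zigzag-odd m (suc m) j ⟩
    j + suc m       ≡⟨ +-suc j m ⟩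
    suc j + m       ≤⟨ +-monoˡ-≤ m (odd<n j t<n) ⟩
    m + m           ≡⟨ m+m≡m*2 m ⟩
    m * 2           ∎)
    where open ≤-Reasoning

  -- On the ascending side the next higher value comes two positions later; on the descending side
  -- it came two positions earlier, except that m is followed at once by m + 1.
  w-up : ∀ t → 2 + t < n → ∃ λ t′ → t′ ≤ 2 + t × w t′ ≡ suc (w t)
  w-up t lt with parity t
  ... | odd j        = suc (suc j * 2) , ≤-refl , trans (zigzag-odd m (suc m) (suc j)) (cong suc (sym (zigzag-odd m (suc m) j)))
  ... | even zero    = 1 , s≤s z≤n , refl
  ... | even (suc j) = j * 2 , ≤-trans (n≤1+n _) (≤-trans (n≤1+n _) (≤-trans (n≤1+n _) (n≤1+n _)))
                     , trans (zigzag-even m (suc m) j) (trans (+-∸-assoc 1 (≤-trans (n≤1+n _) (even<n (suc (suc j)) lt))) (cong suc (sym (zigzag-even m (suc m) (suc j)))))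

  w-down : ∀ t → 2 + t < n → ∃ λ t′ → t′ ≤ 2 + t × suc (w t′) ≡ w t
  w-down t lt with parity t
  ... | even j       = suc j * 2 , ≤-refl
                     , trans (cong suc (zigzag-even m (suc m) (suc j))) (trans (sym (+-∸-assoc 1 (even<n (suc j) lt))) (sym (zigzag-even m (suc m) j)))
  ... | odd zero     = 0 , z≤n , refl
  ... | odd (suc j)  = suc (j * 2) , ≤-trans (n≤1+n _) (≤-trans (n≤1+n _) (≤-trans (n≤1+n _) (n≤1+n _)))
                     , trans (cong suc (zigzag-odd m (suc m) j)) (sym (zigzag-odd m (suc m) (suc j)))

  -- A change of the shift by one is compensated by a neighbouring value of `w`, which occurs at
  -- most two positions later.
  w-shift : ∀ {x x′} → Within 1 x x′ → ∀ t → 2 + t < n → ∃ λ t′ → t′ ≤ 2 + t × x + w t′ ≡ x′ + w t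
  w-shift {x} {x′} (x≤1+x′ , x′≤1+x) t lt with <-cmp x x′
  ... | tri≈ _ refl _ = t , ≤-trans (n≤1+n _) (n≤1+n _) , refl
  ... | tri< x<x′ _ _ with refl ← ≤-antisym x<x′ x′≤1+x with w-up t lt
  ...   | t′ , t′≤ , eq = t′ , t′≤ , trans (cong (x +_) eq) (+-suc x (w t))
  w-shift {x} {x′} (x≤1+x′ , x′≤1+x) t lt | tri> _ _ x′<x with refl ← ≤-antisym x′<x x≤1+x′ with w-down t lt
  ...   | t′ , t′≤ , eq = t′ , t′≤ , trans (sym (+-suc x′ (w t′))) (cong (x′ +_) eq)

  target : ℕ → ℕ → Fin n
  target x t = (x + w t) modᶠ n

  target-injective : ∀ x {t t′} → t < n → t′ < n → target x t ≡ target x t′ → t ≡ t′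
  target-injective x {t} {t′} t<n t′<n eq = w-injective t<n t′<n (%-injective n (w-< t<n) (w-< t′<n) (%-cancelˡ x n
    (trans (sym (toℕ-modᶠ (x + w t) n)) (trans (cong toℕ eq) (toℕ-modᶠ (x + w t′) n)))))

  target-surjective : ∀ x v → ∃ λ t → t < n × target x t ≡ v
  target-surjective x v with injective⇒surjective {f = target x ∘ toℕ}
    (λ {t} {t′} eq → FP.toℕ-injective (target-injective x (FP.toℕ<n t) (FP.toℕ<n t′) eq)) v
  ... | t , eq = toℕ t , FP.toℕ<n t , eq

  hits : ℕ → Fin n → ℕ → ℕ
  hits x v t = ⟦ ⌊ v F.≟ target x t ⌋ ⟧

  -- Within `n` steps `v` is met only at time `τ`, so counting the hits in a prefix amounts to
  -- asking whether `τ` lies in it.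
  sumTo-hits : ∀ x v {τ} → τ < n → target x τ ≡ v → ∀ {a} → a ≤ n → sumTo (hits x v) a ≡ ⟦ ⌊ τ <? a ⌋ ⟧
  sumTo-hits x v {τ} τ<n refl {a} a≤n = trans (sumTo-cong a (λ {t} t<a → cong ⟦_⟧
      (⌊⌋-cong (v F.≟ target x t) (τ ≟ t) (target-injective x τ<n (<-≤-trans t<a a≤n)) (cong (target x)))))
    (sumTo-indicator τ a)

  sumTo-hits-full : ∀ x v → sumTo (hits x v) n ≡ 1
  sumTo-hits-full x v with target-surjective x v
  ... | τ , τ<n , eq = trans (sumTo-hits x v τ<n eq ≤-refl) (cong ⟦_⟧ (⌊⌋-cong (τ <? n) (yes τ<n) id id))

  -- This is where the two edges of slack are spent: a prefix longer by two meets every vertex that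
  -- the shifted zigzag meets.
  sumTo-hits-shift : ∀ {x x′} → Within 1 x x′ → ∀ v {b} → 2 + b ≤ n →
                     sumTo (hits x′ v) b ≤ sumTo (hits x v) (2 + b)
  sumTo-hits-shift {x} {x′} near v {b} 2+b≤n with target-surjective x v | target-surjective x′ v
  ... | τ , τ<n , eq | τ′ , τ′<n , eq′ = subst₂ _≤_
      (sym (sumTo-hits x′ v τ′<n eq′ (≤-trans (n≤1+n _) (≤-trans (n≤1+n _) 2+b≤n))))
      (sym (sumTo-hits x v τ<n eq 2+b≤n))
      (⟦⟧-mono (λ h → fromWitness (earlier (toWitness h))))
    where
    -- The time `t` given by `w-shift` also meets `v` from `x`, so it equals `τ`.
    earlier : τ′ < b → τ < 2 + b
    earlier τ′<b with w-shift near τ′ (<-≤-trans (+-monoʳ-< 2 τ′<b) 2+b≤n)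
    ... | t , t≤ , shifted = subst (_< 2 + b)
      (target-injective x (<-≤-trans t< 2+b≤n) τ<n (trans (cong (_modᶠ n) shifted) (trans eq′ (sym eq)))) t<
      where
      t< : t < 2 + b
      t< = ≤-<-trans t≤ (+-monoʳ-< 2 τ′<b)

-- δ i is the difference d of the i-th 2-factor {x , x + d}. The zigzags of its
-- two endpoints are centred half of d to either side of a common point, so
-- differences at distance at most 2 give centres at distance at most 1.
module Blocks (m q : ℕ) .{{m≢0 : NonZero m}} (δ : ℕ → ℕ)
  (δ-% : ∀ i → δ (i % m) ≡ δ i) (δ>0 : ∀ i → 0 < δ i) (δ≤m : ∀ i → δ i ≤ m)
  (δ-injective : ∀ {i i′} → i < m → i′ < m → δ i ≡ δ i′ → i ≡ i′)
  (δ-step : ∀ i → Within 2 (δ i) (δ (i + q)))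
  (q<m : q < m) where

  open Hits m

  -- The common point is m, so that the subtraction does not truncate; rounding down on one side and
  -- up on the other makes the difference exactly `δ i`.
  left right : ℕ → ℕ
  left  i = m ∸ ⌊ δ i /2⌋
  right i = m + ⌈ δ i /2⌉

  right≡ : ∀ i → right i ≡ left i + δ i
  right≡ i = begin
    m + ⌈ δ i /2⌉                          ≡⟨ cong (_+ ⌈ δ i /2⌉) (m∸n+n≡m (≤-trans (⌊n/2⌋≤n (δ i)) (δ≤m i))) ⟨
    left i + ⌊ δ i /2⌋ + ⌈ δ i /2⌉         ≡⟨ +-assoc (left i) _ _ ⟩
    left i + (⌊ δ i /2⌋ + ⌈ δ i /2⌉)       ≡⟨ cong (left i +_) (⌊n/2⌋+⌈n/2⌉≡n (δ i)) ⟩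
    left i + δ i                           ∎
    where open ≡-Reasoning

  left-step : ∀ i → Within 1 (left i) (left (i + q))
  left-step i = ∸-Within m (⌊n/2⌋-mono (proj₁ (δ-step i)) , ⌊n/2⌋-mono (proj₂ (δ-step i)))

  right-step : ∀ i → Within 1 (right i) (right (i + q))
  right-step i = le (⌈n/2⌉-mono (proj₁ (δ-step i))) , le (⌈n/2⌉-mono (proj₂ (δ-step i)))
    where
    le : ∀ {a b} → a ≤ suc b → m + a ≤ suc (m + b)
    le {a} {b} h = ≤-trans (+-monoʳ-≤ m h) (≤-reflexive (+-suc m b))

  m<n : m < n
  m<n = s≤s (m≤m*n m 2)

  right-target : ∀ i t → toℕ (target (right i) t) ≡ (left i + w t + δ i) % n
  right-target i t = trans (toℕ-modᶠ (right i + w t) n) (cong (_% n) (trans (cong (_+ w t) (right≡ i))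
    (solve 3 (λ a b c → a :+ b :+ c := a :+ c :+ b) refl (left i) (δ i) (w t))))
    where open +-*-Solver

  left-target : ∀ i t → toℕ (target (left i) t) ≡ (left i + w t) % n
  left-target i t = toℕ-modᶠ (left i + w t) n

  %-cancel-self : ∀ a d → d < n → a % n ≡ (a + d) % n → d ≡ 0
  %-cancel-self a d d<n eq = sym (%-injective n (s≤s z≤n) d<n (%-cancelˡ a n (trans (cong (_% n) (+-identityʳ a)) eq)))

  left≢right : ∀ i t → target (left i) t ≢ target (right i) t
  left≢right i t eq = <⇒≢ (δ>0 i) (sym (%-cancel-self (left i + w t) (δ i) (≤-<-trans (δ≤m i) m<n)
    (trans (sym (left-target i t)) (trans (cong toℕ eq) (right-target i t)))))

  blockEdge : ℕ → ℕ → Edge n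
  blockEdge i t = mkEdge (target (left i) t) (target (right i) t) (left≢right i t)

  incidentAt : Fin n → ℕ → ℕ → ℕ
  incidentAt v i t = ⟦ incidentᵇ v (blockEdge i t) ⟧

  -- Periodicity of `δ` lets the block index stay unreduced, as is convenient for windows running
  -- past the last block.
  incidentAt-% : ∀ i t v → incidentAt v (i % m) t ≡ hits (left i) v t + hits (right i) v t
  incidentAt-% i t v = trans (incident-mkEdge v _ _ (left≢right (i % m) t))
    (cong (λ d → hits (m ∸ ⌊ d /2⌋) v t + hits (m + ⌈ d /2⌉) v t) (δ-% i))

  %-+-congˡ : ∀ a b d → a % n ≡ b % n → (a + d) % n ≡ (b + d) % n
  %-+-congˡ a b d eq = trans (%-distribˡ-+ a d n) (trans (cong (λ z → (z + d % n) % n) eq) (sym (%-distribˡ-+ b d n)))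

  -- If the endpoints match in order, the differences agree modulo `n` and hence `i ≡ i′`. If they
  -- match crosswise, δ i + δ i′ is 0 modulo `n`, although it lies between 1 and 2m.
  blockEdge-injective : ∀ {i i′ t t′} → i < m → i′ < m → t < n → t′ < n →
                        blockEdge i t ≡ blockEdge i′ t′ → i ≡ i′ × t ≡ t′
  blockEdge-injective {i} {i′} {t} {t′} i<m i′<m t<n t′<n eq
    with mkEdge-injective (left≢right i t) (left≢right i′ t′) eq
  ... | inj₁ (l≡ , r≡) = i≡i′ , target-injective (left i) t<n t′<n (trans l≡ (cong (λ i → target (left i) t′) (sym i≡i′)))
    where
    a  = left i + w t
    a′ = left i′ + w t′
    a≡a′ : a % n ≡ a′ % n
    a≡a′ = trans (sym (left-target i t)) (trans (cong toℕ l≡) (left-target i′ t′))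
    b≡b′ : (a + δ i) % n ≡ (a′ + δ i′) % n
    b≡b′ = trans (sym (right-target i t)) (trans (cong toℕ r≡) (right-target i′ t′))
    i≡i′ : i ≡ i′
    i≡i′ = δ-injective i<m i′<m (%-injective n (≤-<-trans (δ≤m i) m<n) (≤-<-trans (δ≤m i′) m<n)
      (%-cancelˡ a n (trans b≡b′ (%-+-congˡ a′ a (δ i′) (sym a≡a′)))))
  ... | inj₂ (l≡ , r≡) = contradiction
      (%-cancel-self a (δ i + δ i′) (s≤s (≤-trans (+-mono-≤ (δ≤m i) (δ≤m i′)) (≤-reflexive (m+m≡m*2 m)))) a≡)
      (λ z → <⇒≢ (<-≤-trans (δ>0 i) (m≤m+n (δ i) (δ i′))) (sym z))
    where
    a  = left i + w t
    a′ = left i′ + w t′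
    a≡ : a % n ≡ (a + (δ i + δ i′)) % n
    a≡ = begin
      a % n                    ≡⟨ left-target i t ⟨
      toℕ (target (left i) t)  ≡⟨ cong toℕ l≡ ⟩
      toℕ (target (right i′) t′) ≡⟨ right-target i′ t′ ⟩
      (a′ + δ i′) % n          ≡⟨ %-+-congˡ a′ (a + δ i) (δ i′)
                                    (trans (sym (left-target i′ t′)) (trans (cong toℕ (sym r≡)) (right-target i t))) ⟩
      (a + δ i + δ i′) % n     ≡⟨ cong (_% n) (+-assoc a (δ i) (δ i′)) ⟩
      (a + (δ i + δ i′)) % n   ∎
      where open ≡-Reasoning

  N : ℕ
  N = numEdges n

  N≡m*n : N ≡ m * n
  N≡m*n = numEdges-odd m

  sequence : Fin N → Edge n
  sequence p = blockEdge (toℕ p / n) (toℕ p % n)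

  sequence-injective : Injective _≡_ _≡_ sequence
  sequence-injective {p} {p′} eq = FP.toℕ-injective (trans (m≡m%n+[m/n]*n (toℕ p) n)
      (trans (cong₂ (λ i t → t + i * n) (proj₁ same) (proj₂ same)) (sym (m≡m%n+[m/n]*n (toℕ p′) n))))
    where
    block< : ∀ (p : Fin N) → toℕ p / n < m
    block< p = m<n*o⇒m/o<n (subst (toℕ p <_) N≡m*n (FP.toℕ<n p))
    same = blockEdge-injective (block< p) (block< p′) (m%n<n (toℕ p) n) (m%n<n (toℕ p′) n) eq

  ordering : Ordering n
  ordering = orderingOf sequence sequence-injective

  instance
    mn≢0 : NonZero (m * n)
    mn≢0 = m*n≢0 m n
    N≢0 : NonZero N
    N≢0 = subst NonZero (sym N≡m*n) mn≢0

  -- Degrees in windows of the concatenated blocks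

  blockDegree : Fin n → ℕ → ℕ → ℕ
  blockDegree v i a = sumTo (hits (left i) v) a + sumTo (hits (right i) v) a

  blockDegree-shift : ∀ v i {b} → 2 + b ≤ n → blockDegree v (i + q) b ≤ blockDegree v i (2 + b)
  blockDegree-shift v i {b} le = +-mono-≤ (sumTo-hits-shift (left-step i) v le) (sumTo-hits-shift (right-step i) v le)

  incidence-ordering : ∀ v p → incidence ordering v p ≡ incidentAt v (toℕ (p modᶠ N) / n) (toℕ (p modᶠ N) % n)
  incidence-ordering v p = incidence-orderingOf {n} sequence sequence-injective v p

  incidence-at : ∀ v p → incidence ordering v p ≡ hits (left (p / n)) v (p % n) + hits (right (p / n)) v (p % n)
  incidence-at v p = trans (incidence-ordering v p) 
    (trans (cong₂ (incidentAt v) {toℕ (p modᶠ N) / n} {p / n % m} {toℕ (p modᶠ N) % n} {p % n} block offset)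
           (incidentAt-% (p / n) (p % n) v))
    where
    p%N : toℕ (p modᶠ N) ≡ p % (m * n)
    p%N = trans (toℕ-modᶠ p N) (%-congʳ N≡m*n)
    block : toℕ (p modᶠ N) / n ≡ p / n % m
    block = trans (cong (_/ n) p%N) (m%[n*o]/o≡m/o%n p m n)
    offset : toℕ (p modᶠ N) % n ≡ p % n
    offset = trans (cong (_% n) p%N) (m∣n⇒o%n%m≡o%m n (m * n) p (n∣m*n m))

  incidence≡ : ∀ v i {t} → t < n → incidence ordering v (i * n + t) ≡ hits (left i) v t + hits (right i) v t
  incidence≡ v i {t} t<n = trans (incidence-at v (i * n + t))
    (cong₂ (λ i t → hits (left i) v t + hits (right i) v t) (proj₁ (quotient-unique n i t<n)) (proj₂ (quotient-unique n i t<n)))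

  -- Counts from position 0 along the periodically continued sequence, so the degree in any window,
  -- wrapping or not, is a difference of two values.
  degree : Fin n → ℕ → ℕ
  degree v = sumTo (incidence ordering v)

  block-sum : ∀ v i {a} → a ≤ n → sumTo (incidence ordering v ∘ (i * n +_)) a ≡ blockDegree v i a
  block-sum v i {a} a≤n = trans (sumTo-cong a (λ t<a → incidence≡ v i (<-≤-trans t<a a≤n))) (sumTo-distrib-+ (hits (left i) v) (hits (right i) v) a)

  -- Each block is a 2-factor: either of its two zigzags meets `v` exactly once.
  degree-blocks : ∀ v i → degree v (i * n) ≡ i * 2
  degree-blocks v zero    = refl
  degree-blocks v (suc i) = begin
    degree v (n + i * n)                  ≡⟨ cong (degree v) (+-comm n (i * n)) ⟩
    degree v (i * n + n)                  ≡⟨ sumTo-+ (incidence ordering v) (i * n) n ⟩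
    degree v (i * n) + _                  ≡⟨ cong₂ _+_ (degree-blocks v i) (block-sum v i ≤-refl) ⟩
    i * 2 + blockDegree v i n             ≡⟨ cong (i * 2 +_) (cong₂ _+_ (sumTo-hits-full (left i) v) (sumTo-hits-full (right i) v)) ⟩
    i * 2 + 2                             ≡⟨ +-comm (i * 2) 2 ⟩
    suc i * 2                             ∎
    where open ≡-Reasoning

  degree≡ : ∀ v i {a} → a ≤ n → degree v (i * n + a) ≡ i * 2 + blockDegree v i a
  degree≡ v i {a} a≤n = trans (sumTo-+ (incidence ordering v) (i * n) a) (cong₂ _+_ (degree-blocks v i) (block-sum v i a≤n))

  -- A window of qn - 2 edges starting at offset at most 2 ends no later than block i + q begins, so
  -- it lies inside `q` full blocks.
  degree-window-start : ∀ v i a s → a ≤ 2 → 2 + s ≡ q * n → degree v (i * n + a + s) ≤ degree v (i * n + a) + q * 2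
  degree-window-start v i a s a≤2 2+s≡ = begin
    degree v (i * n + a + s)        ≡⟨ cong (degree v) (+-assoc (i * n) a s) ⟩
    degree v (i * n + (a + s))      ≤⟨ sumTo-mono (incidence ordering v) (+-monoʳ-≤ (i * n) (+-monoˡ-≤ s a≤2)) ⟩
    degree v (i * n + (2 + s))      ≡⟨ cong (degree v) (trans (cong (i * n +_) 2+s≡) (sym (*-distribʳ-+ n i q))) ⟩
    degree v ((i + q) * n)          ≡⟨ degree-blocks v (i + q) ⟩
    (i + q) * 2                     ≡⟨ *-distribʳ-+ 2 i q ⟩
    i * 2 + q * 2                   ≡⟨ cong (_+ q * 2) (degree-blocks v i) ⟨
    degree v (i * n) + q * 2        ≤⟨ +-monoˡ-≤ (q * 2) (sumTo-mono (incidence ordering v) (m≤m+n (i * n) a)) ⟩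
    degree v (i * n + a) + q * 2    ∎
    where open ≤-Reasoning

  -- From offset 2 + b the window omits the first 2 + b edges of block i and takes in the first b
  -- edges of block i + q; by `blockDegree-shift` the gain does not exceed the loss.
  degree-window : ∀ v i a s → a < n → 2 + s ≡ q * n → degree v (i * n + a + s) ≤ degree v (i * n + a) + q * 2
  degree-window v i (suc (suc b)) s a<n 2+s≡ = begin
    degree v (i * n + (2 + b) + s)           ≡⟨ cong (degree v) position ⟩
    degree v ((i + q) * n + b)               ≡⟨ degree≡ v (i + q) (≤-trans (n≤1+n _) (≤-trans (n≤1+n _) (<⇒≤ a<n))) ⟩
    (i + q) * 2 + blockDegree v (i + q) b    ≤⟨ +-monoʳ-≤ ((i + q) * 2) (blockDegree-shift v i (<⇒≤ a<n)) ⟩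
    (i + q) * 2 + blockDegree v i (2 + b)    ≡⟨ solve 3 (λ i q d → (i :+ q) :* con 2 :+ d := i :* con 2 :+ d :+ q :* con 2) refl i q (blockDegree v i (2 + b)) ⟩
    i * 2 + blockDegree v i (2 + b) + q * 2  ≡⟨ cong (_+ q * 2) (degree≡ v i (<⇒≤ a<n)) ⟨
    degree v (i * n + (2 + b)) + q * 2       ∎
    where
    open ≤-Reasoning
    open +-*-Solver
    position : i * n + (2 + b) + s ≡ (i + q) * n + b
    position = trans (solve 3 (λ x b s → x :+ (con 2 :+ b) :+ s := x :+ (con 2 :+ s) :+ b) refl (i * n) b s)
      (cong (_+ b) (trans (cong (i * n +_) 2+s≡) (sym (*-distribʳ-+ n i q))))
  degree-window v i zero       s a<n 2+s≡ = degree-window-start v i 0 s z≤n 2+s≡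
  degree-window v i (suc zero) s a<n 2+s≡ = degree-window-start v i 1 s (s≤s z≤n) 2+s≡

  ordering-regular : ∀ s → 2 + s ≡ q * n → AllWindowsRegular (q * 2) ordering s
  ordering-regular s 2+s≡ k v = subst (_≤ q * 2) (sym (windowDegree-sumTo ordering κ s v s≤N))
    (+-cancelˡ-≤ (degree v κ) _ _ (begin
      degree v κ + sumTo (incidence ordering v ∘ (κ +_)) s   ≡⟨ sumTo-+ (incidence ordering v) κ s ⟨
      degree v (κ + s)                                       ≡⟨ cong (λ z → degree v (z + s)) κ≡ ⟩
      degree v (κ / n * n + κ % n + s)                       ≤⟨ degree-window v (κ / n) (κ % n) s (m%n<n κ n) 2+s≡ ⟩
      degree v (κ / n * n + κ % n) + q * 2                   ≡⟨ cong (λ z → degree v z + q * 2) κ≡ ⟨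
      degree v κ + q * 2                                     ∎))
    where
    open ≤-Reasoning
    κ = toℕ k
    κ≡ : κ ≡ κ / n * n + κ % n
    κ≡ = m≡[m/n]*n+m%n κ n
    s≤N : s ≤ N
    s≤N = ≤-trans (m≤n+m s 2) (≤-trans (≤-reflexive 2+s≡)
      (≤-trans (*-monoˡ-≤ n (<⇒≤ q<m)) (≤-reflexive (sym N≡m*n))))

-- Combining the two bounds

exists-regular : ∀ m q → 0 < q → q < m → ∀ s → 2 + s ≡ q * suc (m * 2) →
  Σ (Ordering (suc (m * 2))) λ ℓ → AllWindowsRegular (q * 2) ℓ s
exists-regular m q 0<q q<m s 2+s≡ = ordering , ordering-regular s 2+s≡
  where
  instance
    m≢0 : NonZero m
    m≢0 = >-nonZero (<-trans 0<q q<m)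
  open Arrangement m q
  open Blocks m q arrange arrange-% (λ _ → s≤s z≤n) arrange-≤ arrange-injective arrange-step q<m

regular-windows-< : ∀ m q → 0 < q → q < m → ∀ s (ℓ : Ordering (suc (m * 2))) →
  AllWindowsRegular (q * 2) ℓ s → s < q * suc (m * 2)
regular-windows-< m q 0<q q<m s ℓ reg = ≰⇒> λ qn≤s → no-regular-windows {suc (m * 2)} q
  (*-mono-< 0<q (s≤s z≤n))
  (subst (q * suc (m * 2) <_) (sym (numEdges-odd m)) (*-monoˡ-< (suc (m * 2)) q<m)) ℓ
  (regular-mono (q * 2) {q * suc (m * 2)} {s} ℓ qn≤s reg)

-- The bounds do not say which of the two values the maximum takes: it is found
-- by searching all orderings.
cms-bounds : ∀ {n r} s → (∀ s′ (ℓ : Ordering n) → AllWindowsRegular r ℓ s′ → s′ ≤ suc s) →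
  (Σ (Ordering n) λ ℓ → AllWindowsRegular r ℓ s) → Σ ℕ λ c → IsCmsK n r c × s ≤ c × c ≤ suc s
cms-bounds {n} {r} s at-most (ℓ₀ , reg₀) with regularOrdering? r (suc s) ℓ₀
... | yes (ℓ , reg) = suc s
    , ((ℓ , reg , λ s′ → at-most s′ ℓ) , λ ℓ′ c′ (reg′ , _) → at-most c′ ℓ′ reg′)
    , n≤1+n s , ≤-refl
... | no none = s
    , ((ℓ₀ , reg₀ , λ s′ → at-most-s s′ ℓ₀) , λ ℓ′ c′ (reg′ , _) → at-most-s c′ ℓ′ reg′)
    , ≤-refl , n≤1+n s
  where
  at-most-s : ∀ s′ (ℓ : Ordering n) → AllWindowsRegular r ℓ s′ → s′ ≤ s
  at-most-s s′ ℓ reg = ≮⇒≥ λ 1+s≤s′ → none (ℓ , regular-mono r {suc s} {s′} ℓ 1+s≤s′ reg)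

theorem6 : (n r : ℕ) → 3 ≤ n → 1 ≤ r → r ≤ n ∸ 2 → ¬ (2 ∣ n) → 2 ∣ r →
    Σ ℕ (λ c → IsCmsK n r c
    × ((r * n ∸ 1) / 2) ∸ 1 ≤ c
    × c ≤ (r * n ∸ 1) / 2)
theorem6 n r 3≤n 1≤r r≤n∸2 2∤n (divides q refl) with parity n
... | even m = contradiction (divides m refl) 2∤n
... | odd m  = subst (λ x → Σ ℕ (λ c → IsCmsK (suc (m * 2)) (q * 2) c × x ∸ 1 ≤ c × c ≤ x)) (sym half)
                 (cms-bounds {suc (m * 2)} {q * 2} s
                   (λ s′ ℓ reg → m<1+n⇒m≤n (subst (s′ <_) (sym 2+s≡) (regular-windows-< m q 0<q q<m s′ ℓ reg)))
                   (exists-regular m q 0<q q<m s 2+s≡))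
  where
  0<q : 0 < q
  0<q = *-cancelʳ-< 2 0 q 1≤r
  q<m : q < m
  q<m = *-cancelʳ-< 2 q m (begin-strict
    q * 2           ≤⟨ r≤n∸2 ⟩
    m * 2 ∸ 1       <⟨ ∸-monoʳ-< {m * 2} (s≤s z≤n) (m<1+n⇒m≤n (≤-trans (n≤1+n 2) 3≤n)) ⟩
    m * 2           ∎)
    where open ≤-Reasoning
  -- The window length of the construction; `suc s` is the upper bound qn - 1.
  s = q * suc (m * 2) ∸ 2
  2≤qn : 2 ≤ q * suc (m * 2)
  2≤qn = ≤-trans (≤-trans (n≤1+n 2) 3≤n) (m≤n*m _ q {{>-nonZero 0<q}})
  2+s≡ : 2 + s ≡ q * suc (m * 2)
  2+s≡ = m+[n∸m]≡n 2≤qn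
  -- Here rn - 1 = 1 + 2(qn - 1), and halving drops the 1.
  half : (q * 2 * suc (m * 2) ∸ 1) / 2 ≡ suc s
  half = begin
    (q * 2 * suc (m * 2) ∸ 1) / 2  ≡⟨ cong (λ z → (z ∸ 1) / 2) (trans (solve 2 (λ q n → q :* con 2 :* n := q :* n :* con 2) refl q (suc (m * 2))) (cong (_* 2) (sym 2+s≡))) ⟩
    (1 + suc s * 2) / 2            ≡⟨ +-distrib-/-∣ʳ 1 {suc s * 2} {2} (divides (suc s) refl) ⟩
    suc s * 2 / 2                  ≡⟨ m*n/n≡m (suc s) 2 ⟩
    suc s                          ∎
    where
    open ≡-Reasoning
    open +-*-Solver
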